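{- For every integer $n\ge 1$ there is a split permutation graph with $4n^3$ vertices that contains every split permutation graph with $n$ vertices as an induced subgraph.
   Context: All graphs are finite, simple, undirected. A graph is split if its vertex set can be partitioned into a clique and an independent set. The permutation graph of a permutation $\pi$ of $[m]$ has vertex set $[m]$, with $i<j$ adjacent iff $j$ appears before $i$ in the one-line notation of $\pi$; a permutation graph is any graph isomorphic to such a graph. A split permutation graph is a graph that is both a split graph and a permutation graph. -}

module Defs where

open import Data.Nat using (ℕ)
open import Data.Bool using (Bool; true; false; _∧_; _∨_)
open import Data.Fin using (Fin; _<_)
open import Data.Fin.Properties using (_<?_)
open import Data.Product using (Σ; _×_; ∃)
open import Relation.Nullary using (¬_)
open import Relation.Nullary.Decidable using (⌊_⌋)
open import Relation.Binary.PropositionalEquality using (_≡_; _≢_)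
open import Function.Bundles using (_↔_; Inverse)
open import Function.Definitions using (Injective)

record Graph (m : ℕ) : Set where
  field
    adj     : Fin m → Fin m → Bool
    symm    : ∀ i j → adj i j ≡ adj j i
    irrefl  : ∀ i → adj i i ≡ false
open Graph public

IsSplit : ∀ {m} → Graph m → Set
IsSplit {m} G = Σ (Fin m → Bool) λ inC →
  (∀ i j → i ≢ j → inC i ≡ true → inC j ≡ true → adj G i j ≡ true) ×
  (∀ i j → inC i ≡ false → inC j ≡ false → adj G i j ≡ false)

-- Adjacency of the permutation graph of π (π given as a bijection of Fin m,
-- one-line notation π(0) π(1) ... π(m-1)). The position of value v is π⁻¹ v.
-- For i < j: adjacent iff j appears before i, i.e. pos j < pos i.
permAdj : ∀ {m} → (Fin m ↔ Fin m) → Fin m → Fin m → Bool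
permAdj π i j =
  (⌊ i <? j ⌋ ∧ ⌊ pos j <? pos i ⌋) ∨ (⌊ j <? i ⌋ ∧ ⌊ pos i <? pos j ⌋)
  where pos = Inverse.from π

IsPermutationGraph : ∀ {m} → Graph m → Set
IsPermutationGraph {m} G =
  Σ (Fin m ↔ Fin m) λ π → Σ (Fin m ↔ Fin m) λ f →
    ∀ i j → adj G i j ≡ permAdj π (Inverse.to f i) (Inverse.to f j)

IsSplitPermutationGraph : ∀ {m} → Graph m → Set
IsSplitPermutationGraph G = IsSplit G × IsPermutationGraph G

IsInducedSubgraph : ∀ {n m} → Graph n → Graph m → Set
IsInducedSubgraph {n} {m} H G =
  Σ (Fin n → Fin m) λ f → Injective _≡_ _≡_ f ×
    (∀ i j → adj H i j ≡ adj G (f i) (f j))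

{-# OPTIONS --safe #-}
module Submission where

-- A permutation drawing of a split graph is an X: a decreasing clique K = K₁ ∪ K₂ and an
-- increasing independent set, each running through a common centre. An independent vertex i
-- misses an initial part of K₁ and of K₂, counted from the centre, so the graph is encoded by
-- the lengths reach₁ i, reach₂ i of these parts. No three independent vertices are pairwise
-- crossing (reach₁ i < reach₁ j but reach₂ j < reach₂ i), hence the independent set can be
-- redistributed into chains A and B such that no b in B crosses a member of A in this direction.
-- Then all vertices fit on a single line on which adjacency between K₁ and A ∪ B and between
-- K₂ and A is comparison, while k in K₂ and b in B are non-adjacent iff k is "far below" b.
-- This relation is monotone, so the line can be placed in ℕ with "far" meaning a difference of
-- at least a fixed unit; replacing residues modulo the unit by their ranks, the unit becomes n
-- and all positions are below n². The host is therefore an X with arms of length n³ ≥ n², one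
-- of them shifted by n.

open import Defs
open import Level using (0ℓ)
open import Data.Bool using (Bool; true; false; if_then_else_; _∧_; _∨_)
open import Data.Bool.Properties as Bool using (∨-comm)
open import Data.Fin using (Fin; zero; suc; toℕ; fromℕ<; punchOut; combine; remQuot)
open import Data.Fin.Properties using (any?; toℕ<n; toℕ-injective; toℕ-fromℕ<; fromℕ<-injective; punchOut-injective; injective⇒≤; remQuot-combine; combine-remQuot)
import Data.Fin.Properties as Fin using (_<?_; _≟_)
open import Data.Fin.Subset using (Subset; _∈_; _∉_; ∣_∣; ⊤)
open import Data.Fin.Subset.Properties using (∣⊤∣≡n; ∈⊤; p⊆q⇒∣p∣≤∣q∣; p⊂q⇒∣p∣<∣q∣)
open import Data.Integer using (ℤ; +_; -[1+_]; +<+; -<+; -<-)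
import Data.Integer.Properties as ℤ
open import Data.Nat using (ℕ; zero; suc; _+_; _*_; _^_; _≤_; _<_; _≥_; _∸_; z≤n; s≤s; _⊔_; NonZero; >-nonZero)
open import Data.Nat.DivMod using (_/_; _%_; m≡m%n+[m/n]*n; m%n<n; m<n*o⇒m/o<n)
open import Data.Nat.Properties
open import Data.Product as Product using (Σ; ∃; _×_; _,_; proj₁; proj₂; uncurry)
open import Data.Product.Properties using (×-≡,≡→≡)
open import Data.Product.Relation.Binary.Lex.Strict using (×-strictTotalOrder)
open import Data.Sum as Sum using (_⊎_; inj₁; inj₂; [_,_]′)
open import Data.Unit using (tt)
open import Data.Vec using (tabulate)
open import Data.Vec.Properties using (lookup∘tabulate; lookup⇒[]=; []=⇒lookup)
open import Function using (_∘_; _↔_; Injection; Injective; Inverse; mk⇔; mk↔ₛ′)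
open import Function.Properties.Inverse using (↔-sym; ↔-trans; ↔⇒↣)
open import Relation.Binary using (StrictTotalOrder; tri<; tri≈; tri>)
open import Relation.Binary.PropositionalEquality using (_≡_; _≢_; refl; sym; trans; cong; cong₂; subst; subst₂; module ≡-Reasoning)
open import Relation.Nullary using (Dec; yes; no; does; ¬_; contradiction; ¬?; _×-dec_; _⊎-dec_)
open import Relation.Nullary.Decidable using (toSum; dec-true; dec-false; isYes≗does; ⌊_⌋; decidable-stable; does-⇔; does-≡)
open import Relation.Unary using (Decidable)

-- Ranks of keys in a strict total order.

comprehension : ∀ {n} {P : Fin n → Set} → Decidable P → Subset n
comprehension P? = tabulate (does ∘ P?)

module _ {n} {P : Fin n → Set} (P? : Decidable P) where

  ∈-comprehension⁺ : ∀ {i} → P i → i ∈ comprehension P?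
  ∈-comprehension⁺ {i} p = lookup⇒[]= i _ (trans (lookup∘tabulate _ i) (dec-true (P? i) p))

  ∈-comprehension⁻ : ∀ {i} → i ∈ comprehension P? → P i
  ∈-comprehension⁻ {i} i∈ with P? i | trans (sym (lookup∘tabulate (does ∘ P?) i)) ([]=⇒lookup i∈)
  ... | yes p | _ = p
  ... | no _  | ()

module Rank {n} (O : StrictTotalOrder 0ℓ 0ℓ 0ℓ) (key : Fin n → StrictTotalOrder.Carrier O) where
  open StrictTotalOrder O using (compare) renaming (_<_ to _≺_; _<?_ to _≺?_; _≈_ to _≈_; irrefl to ≺-irrefl; trans to ≺-trans; <-respʳ-≈ to ≺-respʳ-≈; module Eq to ≈)

  below : Fin n → Subset n
  below i = comprehension (λ j → key j ≺? key i)

  i∉below-i : ∀ i → i ∉ below i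
  i∉below-i i i∈ = ≺-irrefl ≈.refl (∈-comprehension⁻ (λ j → key j ≺? key i) i∈)

  abstract
    -- Only strictly smaller keys are counted, so equivalent keys share a rank and the order is both
    -- preserved and reflected without injectivity. `Compress` relies on this, since residues may
    -- coincide.
    rank : Fin n → ℕ
    rank i = ∣ below i ∣

    rank<n : ∀ i → rank i < n
    rank<n i = subst (rank i <_) (∣⊤∣≡n n) (p⊂q⇒∣p∣<∣q∣ ((λ _ → ∈⊤) , i , ∈⊤ , i∉below-i i))

    rank-mono-< : ∀ {i j} → key i ≺ key j → rank i < rank j
    rank-mono-< {i} {j} i≺j = p⊂q⇒∣p∣<∣q∣
      ( (λ k∈ → ∈-comprehension⁺ (λ k → key k ≺? key j) (≺-trans (∈-comprehension⁻ (λ k → key k ≺? key i) k∈) i≺j))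
      , i , ∈-comprehension⁺ (λ k → key k ≺? key j) i≺j , i∉below-i i)

    rank-mono-≤ : ∀ {i j} → ¬ key j ≺ key i → rank i ≤ rank j
    rank-mono-≤ {i} {j} j⊀i with compare (key i) (key j)
    ... | tri< i≺j _ _ = <⇒≤ (rank-mono-< i≺j)
    ... | tri> _ _ j≺i = contradiction j≺i j⊀i
    ... | tri≈ _ i≈j _ = p⊆q⇒∣p∣≤∣q∣ (λ k∈ →
      ∈-comprehension⁺ (λ k → key k ≺? key j) (≺-respʳ-≈ i≈j (∈-comprehension⁻ (λ k → key k ≺? key i) k∈)))

    rank-cancel-< : ∀ {i j} → rank i < rank j → key i ≺ key j
    rank-cancel-< {i} {j} ri<rj = decidable-stable (key i ≺? key j) (λ i⊀j → <⇒≱ ri<rj (rank-mono-≤ i⊀j))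

    rank-injective : Injective _≡_ _≈_ key → Injective _≡_ _≡_ rank
    rank-injective inj {i} {j} ri≡rj with compare (key i) (key j)
    ... | tri< i≺j _ _ = contradiction ri≡rj (<⇒≢ (rank-mono-< i≺j))
    ... | tri≈ _ i≈j _ = inj i≈j
    ... | tri> _ _ j≺i = contradiction (sym ri≡rj) (<⇒≢ (rank-mono-< j≺i))

mono-<⇒injective : ∀ {V : Set} (f g : V → ℕ) → (∀ {u v} → f u < f v → g u < g v) →
                   Injective _≡_ _≡_ f → Injective _≡_ _≡_ g
mono-<⇒injective f g mono f-inj {u} {v} gu≡gv with <-cmp (f u) (f v)
... | tri< fu<fv _ _ = contradiction gu≡gv (<⇒≢ (mono fu<fv))
... | tri≈ _ fu≡fv _ = f-inj fu≡fv
... | tri> _ _ fv<fu = contradiction (sym gu≡gv) (<⇒≢ (mono fv<fu))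

-- Pigeonhole: were a value omitted, punching it out would inject `Fin (suc k)` into `Fin k`.
injective⇒↔ : ∀ {m} (f : Fin m → Fin m) → Injective _≡_ _≡_ f → Fin m ↔ Fin m
injective⇒↔ {m} f inj = mk↔ₛ′ f (proj₁ ∘ preimage) (proj₂ ∘ preimage) (λ x → inj (proj₂ (preimage (f x))))
  where
  omitted : ∀ {k} (g : Fin (suc k) → Fin (suc k)) → Injective _≡_ _≡_ g → ∀ y → ¬ (∀ x → y ≢ g x)
  omitted g g-inj y y∉ = 1+n≰n (injective⇒≤ (λ eq → g-inj (punchOut-injective (y∉ _) (y∉ _) eq)))
  surjective : ∀ {k} (g : Fin k → Fin k) → Injective _≡_ _≡_ g → ∀ y → ∃ λ x → g x ≡ y
  surjective {suc k} g g-inj y = decidable-stable (any? (λ x → g x Fin.≟ y))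
    (λ ∄x → omitted g g-inj y (λ x y≡gx → ∄x (x , sym y≡gx)))
  preimage : ∀ y → ∃ λ x → f x ≡ y
  preimage = surjective f inj

-- Inversion graphs of points in the plane.

module Plane (O : StrictTotalOrder 0ℓ 0ℓ 0ℓ) {V : Set} (X Y : V → StrictTotalOrder.Carrier O) where
  open StrictTotalOrder O using (asym) renaming (_<_ to _≺_; _<?_ to _≺?_; irrefl to ≺-irrefl; module Eq to ≈)

  Inverted : V → V → Set
  Inverted u v = (X u ≺ X v × Y v ≺ Y u) ⊎ (X v ≺ X u × Y u ≺ Y v)

  -- A positive certificate of non-adjacency, which a configuration of two points can supply
  -- directly.
  Concordant : V → V → Set
  Concordant u v = (X u ≺ X v × Y u ≺ Y v) ⊎ (X v ≺ X u × Y v ≺ Y u)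

  concordant⇒¬inverted : ∀ u v → Concordant u v → ¬ Inverted u v
  concordant⇒¬inverted _ _ (inj₁ (_ , y<)) (inj₁ (_ , y>)) = asym y< y>
  concordant⇒¬inverted _ _ (inj₁ (x< , _)) (inj₂ (x> , _)) = asym x< x>
  concordant⇒¬inverted _ _ (inj₂ (x> , _)) (inj₁ (x< , _)) = asym x< x>
  concordant⇒¬inverted _ _ (inj₂ (_ , y>)) (inj₂ (_ , y<)) = asym y< y>

  inverted-irrefl : ∀ {u} → ¬ Inverted u u
  inverted-irrefl (inj₁ (x< , _)) = ≺-irrefl ≈.refl x<
  inverted-irrefl (inj₂ (x< , _)) = ≺-irrefl ≈.refl x<

  inverted? : ∀ u v → Dec (Inverted u v)
  inverted? u v = ((X u ≺? X v) ×-dec (Y v ≺? Y u)) ⊎-dec ((X v ≺? X u) ×-dec (Y u ≺? Y v))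

  inverted?-sym : ∀ u v → does (inverted? u v) ≡ does (inverted? v u)
  inverted?-sym u v = ∨-comm (does (X u ≺? X v) ∧ does (Y v ≺? Y u)) _

module InversionGraph (O : StrictTotalOrder 0ℓ 0ℓ 0ℓ) {m} (X Y : Fin m → StrictTotalOrder.Carrier O) where
  open StrictTotalOrder O using (_≈_) renaming (_<?_ to _≺?_)
  open Plane O X Y

  graph : Graph m
  graph = record
    { adj    = λ i j → does (inverted? i j)
    ; symm   = inverted?-sym
    ; irrefl = λ i → dec-false (inverted? i i) inverted-irrefl
    }

  module _ (X-inj : Injective _≡_ _≈_ X) (Y-inj : Injective _≡_ _≈_ Y) where

    rank↔ : (key : Fin m → StrictTotalOrder.Carrier O) → Injective _≡_ _≈_ key → Fin m ↔ Fin m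
    rank↔ key inj = injective⇒↔ (λ i → fromℕ< (rank<n i))
      (λ {i} {j} eq → rank-injective inj (fromℕ<-injective _ _ (rank<n i) (rank<n j) eq))
      where open Rank O key

    rank-<? : (key : Fin m → StrictTotalOrder.Carrier O) (inj : Injective _≡_ _≈_ key) → ∀ i j →
              does (key i ≺? key j) ≡ ⌊ Inverse.to (rank↔ key inj) i Fin.<? Inverse.to (rank↔ key inj) j ⌋
    rank-<? key inj i j = trans
      (does-⇔ (mk⇔ (λ i≺j → subst₂ _<_ (sym (toℕ-fromℕ< (rank<n i))) (sym (toℕ-fromℕ< (rank<n j))) (rank-mono-< i≺j))
                   (λ ri<rj → rank-cancel-< (subst₂ _<_ (toℕ-fromℕ< (rank<n i)) (toℕ-fromℕ< (rank<n j)) ri<rj)))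
              (key i ≺? key j) ri<?rj)
      (sym (isYes≗does ri<?rj))
      where
      open Rank O key
      ri<?rj = Inverse.to (rank↔ key inj) i Fin.<? Inverse.to (rank↔ key inj) j

    isPermutationGraph : IsPermutationGraph graph
    -- The rank in X serves as value and the rank in Y as position; the permutation sends positions
    -- to values, so `pos` below is its inverse.
    isPermutationGraph = ↔-trans (↔-sym byY) byX , byX , adj≡
      where
      byX = rank↔ X X-inj
      byY = rank↔ Y Y-inj
      pos : Fin m → Fin m
      pos = Inverse.to byY ∘ Inverse.from byX
      pos-byX : ∀ i → Inverse.to byY i ≡ pos (Inverse.to byX i)
      pos-byX i = cong (Inverse.to byY) (sym (Inverse.strictlyInverseʳ byX i))
      x-<? : ∀ i j → does (X i ≺? X j) ≡ ⌊ Inverse.to byX i Fin.<? Inverse.to byX j ⌋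
      x-<? = rank-<? X X-inj
      y-<? : ∀ i j → does (Y i ≺? Y j) ≡ ⌊ pos (Inverse.to byX i) Fin.<? pos (Inverse.to byX j) ⌋
      y-<? i j = trans (rank-<? Y Y-inj i j) (cong₂ (λ a b → ⌊ a Fin.<? b ⌋) (pos-byX i) (pos-byX j))
      adj≡ : ∀ i j → adj graph i j ≡ permAdj (↔-trans (↔-sym byY) byX) (Inverse.to byX i) (Inverse.to byX j)
      adj≡ i j = cong₂ _∨_ (cong₂ _∧_ (x-<? i j) (y-<? j i)) (cong₂ _∧_ (x-<? j i) (y-<? i j))

-- Maxima over decidable subsets.

-- The empty maximum is 0. For `reach₁` and `reach₂`, maxima of successors, the value 0 therefore
-- means that no clique vertex of that part is missed.
⨆ : ∀ {n} {P : Fin n → Set} → Decidable P → (Fin n → ℕ) → ℕ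
⨆ {zero}  P? g = 0
⨆ {suc n} P? g = (if does (P? zero) then g zero else 0) ⊔ ⨆ (P? ∘ suc) (g ∘ suc)

⨆-upper : ∀ {n} {P : Fin n → Set} (P? : Decidable P) g {k} → P k → g k ≤ ⨆ P? g
⨆-upper P? g {zero} p with P? zero
... | yes _ = m≤m⊔n _ _
... | no ¬p = contradiction p ¬p
⨆-upper P? g {suc k} p = ≤-trans (⨆-upper (P? ∘ suc) (g ∘ suc) p) (m≤n⊔m _ _)

⨆-least : ∀ {n} {P : Fin n → Set} (P? : Decidable P) g {b} → (∀ k → P k → g k ≤ b) → ⨆ P? g ≤ b
⨆-least {zero}  P? g g≤b = z≤n
⨆-least {suc n} P? g g≤b with P? zero
... | yes p = ⊔-lub (g≤b zero p) (⨆-least (P? ∘ suc) (g ∘ suc) (λ k → g≤b (suc k)))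
... | no _  = ⨆-least (P? ∘ suc) (g ∘ suc) (λ k → g≤b (suc k))

-- Two-digit numbers and change of base.

digits-mono-< : ∀ {b r r′} l l′ → r < b → l < l′ ⊎ (l ≡ l′ × r < r′) → r + l * b < r′ + l′ * b
digits-mono-< {b} {r} {r′} l l′ r<b (inj₁ l<l′) = begin-strict
  r + l * b   <⟨ +-monoˡ-< (l * b) r<b ⟩
  suc l * b   ≤⟨ *-monoˡ-≤ b l<l′ ⟩
  l′ * b      ≤⟨ m≤n+m (l′ * b) r′ ⟩
  r′ + l′ * b ∎
  where open ≤-Reasoning
digits-mono-< {b} l _ r<b (inj₂ (refl , r<r′)) = +-monoˡ-< (l * b) r<r′

digits-cancel-< : ∀ {b r r′} l l′ → r′ < b → r + l * b < r′ + l′ * b → l < l′ ⊎ (l ≡ l′ × r < r′)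
digits-cancel-< {b} l l′ r′<b lt with <-cmp l l′
... | tri< l<l′ _ _ = inj₁ l<l′
... | tri≈ _ refl _ = inj₂ (refl , +-cancelʳ-< (l * b) _ _ lt)
... | tri> _ _ l′<l = contradiction lt (<-asym (digits-mono-< l′ l r′<b (inj₁ l′<l)))

-- Two-digit numbers compare lexicographically, so the comparison survives a new base as long as the
-- order of the low digits does.
change-base-< : ∀ {a b r r′ R R′} l l′ → r′ < a → R < b → (r < r′ → R < R′) →
                r + l * a < r′ + l′ * a → R + l * b < R′ + l′ * b
change-base-< l l′ r′<a R<b r⇒R lt = digits-mono-< l l′ R<b (Sum.map₂ (Product.map₂ r⇒R) (digits-cancel-< l l′ r′<a lt))

-- Unit representations of monotone relations.

-- As in the Scott–Suppes theorem on semiorders, the points are placed from left to right;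
-- doubling the scale at each step makes room for the next one.
module UnitInterval {Far : ℕ → ℕ → Set} (Far? : ∀ x y → Dec (Far x y))
  (Far-mono : ∀ {x x′ y y′} → x′ ≤ x → y ≤ y′ → Far x y → Far x′ y′)
  (Far⇒< : ∀ {x y} → Far x y → x < y) where

  record Representation (N : ℕ) : Set where
    field
      unit     : ℕ
      unit>0   : 0 < unit
      place    : ℕ → ℕ
      monotone : ∀ {x y} → x < y → y < N → place x < place y
      far      : ∀ {x y} → y < N → Far x y → place x + unit ≤ place y
      near     : ∀ {x y} → x < N → y < N → ¬ Far x y → place y < place x + unit
      -- This keeps the quotient of `place x` by the unit at most x, which later puts the compressed
      -- positions below n².
      bounded  : ∀ {x} → x < N → place x < unit * suc x

  module Extend {N} (R : Representation N) where
    open Representation R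

    -- The lower bound that an old point imposes on the place of the new point N, before doubling.
    farBelow : Fin N → ℕ
    farBelow x = if does (Far? (toℕ x) N) then place (toℕ x) + unit else place (toℕ x)

    top : ℕ
    top = ⨆ (λ _ → yes tt) farBelow

    -- Old points become even and the new one odd: `suc (2 * top)` strictly exceeds every
    -- `2 * place x`, yet stays strictly below `2 * (place x + unit)` whenever
    -- `top < place x + unit`.
    place′ : ℕ → ℕ
    place′ x = if does (x <? N) then 2 * place x else suc (2 * top)

    place′-old : ∀ {x} → x < N → place′ x ≡ 2 * place x
    place′-old {x} x<N rewrite dec-true (x <? N) x<N = refl

    place′-new : place′ N ≡ suc (2 * top)
    place′-new rewrite dec-false (N <? N) (<-irrefl refl) = refl

    farBelow≤top : ∀ {x} → x < N → (if does (Far? x N) then place x + unit else place x) ≤ top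
    farBelow≤top {x} x<N = subst (λ z → (if does (Far? z N) then place z + unit else place z) ≤ top)
      (toℕ-fromℕ< x<N) (⨆-upper (λ _ → yes tt) farBelow {fromℕ< x<N} tt)

    place≤top : ∀ {x} → x < N → place x ≤ top
    place≤top {x} x<N with Far? x N | farBelow≤top x<N
    ... | yes _ | le = ≤-trans (m≤m+n _ _) le
    ... | no _  | le = le

    far≤top : ∀ {x} → x < N → Far x N → place x + unit ≤ top
    far≤top {x} x<N fx with Far? x N | farBelow≤top x<N
    ... | yes _ | le = le
    ... | no ¬f | _  = contradiction fx ¬f

    -- No lower bound conflicts with the upper bound set by x. If z is far from N then z lies left
    -- of x, as otherwise x would be far too; if z is not far, then x is not far from z, since
    -- `Far x z` would give `Far x N`.
    top<near : ∀ {x} → x < N → ¬ Far x N → top < place x + unit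
    top<near {x} x<N ¬fx = ≤-trans (s≤s (⨆-least (λ _ → yes tt) farBelow (λ z _ → below z))) (≤-reflexive (m+[n∸m]≡n 1≤))
      where
      1≤ : 1 ≤ place x + unit
      1≤ = ≤-trans unit>0 (m≤n+m _ _)
      pred′ : ∀ {m} → m < place x + unit → m ≤ place x + unit ∸ 1
      pred′ lt = ∸-monoˡ-≤ 1 lt
      below : ∀ z → farBelow z ≤ place x + unit ∸ 1
      below z with Far? (toℕ z) N
      ... | yes fz = pred′ (+-monoˡ-< unit (monotone (≰⇒> (λ x≤z → ¬fx (Far-mono x≤z ≤-refl fz))) x<N))
      ... | no _   = pred′ (near x<N (toℕ<n z) (λ fxz → ¬fx (Far-mono ≤-refl (<⇒≤ (toℕ<n z)) fxz)))

    top-bounded : top < unit * suc N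
    top-bounded = ≤-trans (s≤s (⨆-least (λ _ → yes tt) farBelow (λ z _ → below z))) (≤-reflexive (m+[n∸m]≡n 1≤))
      where
      1≤ : 1 ≤ unit * suc N
      1≤ = ≤-trans unit>0 (m≤m*n unit (suc N))
      place+unit< : ∀ z → place (toℕ {N} z) + unit < unit * suc N
      place+unit< z = begin-strict
        place (toℕ z) + unit       <⟨ +-monoˡ-< unit (bounded (toℕ<n z)) ⟩
        unit * suc (toℕ z) + unit  ≤⟨ +-monoˡ-≤ unit (*-monoʳ-≤ unit (toℕ<n z)) ⟩
        unit * N + unit            ≡⟨ +-comm (unit * N) unit ⟩
        unit + unit * N            ≡⟨ *-suc unit N ⟨
        unit * suc N               ∎
        where open ≤-Reasoning
      below : ∀ z → farBelow z ≤ unit * suc N ∸ 1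
      below z with Far? (toℕ z) N
      ... | yes _ = ∸-monoˡ-≤ 1 (place+unit< z)
      ... | no _  = ∸-monoˡ-≤ 1 (≤-trans (s≤s (m≤m+n _ unit)) (place+unit< z))

    doubled< : ∀ {m k} → m < k → suc (2 * m) < 2 * k
    doubled< {m} {k} m<k = ≤-trans (≤-reflexive (sym (*-suc 2 m))) (*-monoʳ-≤ 2 m<k)

    extend : Representation (suc N)
    extend = record
      { unit = 2 * unit ; unit>0 = ≤-trans unit>0 (m≤n*m unit 2) ; place = place′
      ; monotone = λ x<y y<1+N → mono x<y (m≤n⇒m<n∨m≡n (≤-pred y<1+N))
      ; far = λ y<1+N → far′ (m≤n⇒m<n∨m≡n (≤-pred y<1+N))
      ; near = λ x<1+N y<1+N → near′ (m≤n⇒m<n∨m≡n (≤-pred x<1+N)) (m≤n⇒m<n∨m≡n (≤-pred y<1+N))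
      ; bounded = λ x<1+N → bounded′ (m≤n⇒m<n∨m≡n (≤-pred x<1+N))
      }
      where
      double-+ : ∀ m → 2 * m + 2 * unit ≡ 2 * (m + unit)
      double-+ m = sym (*-distribˡ-+ 2 m unit)
      mono : ∀ {x y} → x < y → y < N ⊎ y ≡ N → place′ x < place′ y
      mono x<y (inj₁ y<N) rewrite place′-old y<N | place′-old (<-trans x<y y<N) = *-monoʳ-< 2 (monotone x<y y<N)
      mono x<N (inj₂ refl) rewrite place′-new | place′-old x<N = s≤s (*-monoʳ-≤ 2 (place≤top x<N))
      far′ : ∀ {x y} → y < N ⊎ y ≡ N → Far x y → place′ x + 2 * unit ≤ place′ y
      far′ {x} (inj₁ y<N) fxy rewrite place′-old y<N | place′-old (<-trans (Far⇒< fxy) y<N) | double-+ (place x) =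
        *-monoʳ-≤ 2 (far y<N fxy)
      far′ {x} (inj₂ refl) fxy rewrite place′-new | place′-old (Far⇒< fxy) | double-+ (place x) =
        m≤n⇒m≤1+n (*-monoʳ-≤ 2 (far≤top (Far⇒< fxy) fxy))
      near′ : ∀ {x y} → x < N ⊎ x ≡ N → y < N ⊎ y ≡ N → ¬ Far x y → place′ y < place′ x + 2 * unit
      near′ {x} (inj₁ x<N) (inj₁ y<N) ¬f rewrite place′-old x<N | place′-old y<N | double-+ (place x) =
        *-monoʳ-< 2 (near x<N y<N ¬f)
      near′ {x} (inj₁ x<N) (inj₂ refl) ¬f rewrite place′-old x<N | place′-new | double-+ (place x) =
        doubled< (top<near x<N ¬f)
      near′ (inj₂ refl) (inj₁ y<N) _ = ≤-trans (mono y<N (inj₂ refl)) (m≤m+n _ _)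
      near′ (inj₂ refl) (inj₂ refl) _ = m<m+n (place′ N) (≤-trans unit>0 (m≤n*m unit 2))
      bounded′ : ∀ {x} → x < N ⊎ x ≡ N → place′ x < 2 * unit * suc x
      bounded′ {x} (inj₁ x<N) rewrite place′-old x<N | *-assoc 2 unit (suc x) = *-monoʳ-< 2 (bounded x<N)
      bounded′ {x} (inj₂ refl) rewrite place′-new | *-assoc 2 unit (suc x) = doubled< top-bounded

  representation : ∀ N → Representation N
  representation zero    = record
    { unit = 1 ; unit>0 = s≤s z≤n ; place = λ _ → 0
    ; monotone = λ _ () ; far = λ () ; near = λ () ; bounded = λ () }
  representation (suc N) = Extend.extend (representation N)

-- Reduction of the unit to n.

module Compress {n} (p : Fin n → ℕ) (s : ℕ) .{{_ : NonZero s}} where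
  open Rank <-strictTotalOrder (λ v → p v % s)

  abstract
    compress : Fin n → ℕ
    compress v = rank v + p v / s * n

    compress<n*n : (∀ v → p v < s * n) → ∀ v → compress v < n * n
    -- The bound n * n is read as low digit 0 and high digit n.
    compress<n*n p<s*n v = digits-mono-< {r′ = 0} (p v / s) n (rank<n v) (inj₁ level<n)
      where
      level<n : p v / s < n
      level<n = m<n*o⇒m/o<n (subst (p v <_) (*-comm s n) (p<s*n v))

    digits : ∀ v → p v ≡ p v % s + p v / s * s
    digits v = m≡m%n+[m/n]*n (p v) s

    carry : ∀ r l b → r + l * b + b ≡ r + suc l * b
    carry r l b = trans (+-assoc r _ b) (cong (λ z → r + z) (+-comm _ b))

    -- Adding the unit only increments the quotient, so nearness and farness are again lexicographic
    -- comparisons of the same digits.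
    digits-+s : ∀ v → p v + s ≡ p v % s + suc (p v / s) * s
    digits-+s v = trans (cong (_+ s) (digits v)) (carry _ (p v / s) s)

    compress-mono-< : ∀ {u v} → p u < p v → compress u < compress v
    compress-mono-< {u} {v} pu<pv = change-base-< (p u / s) (p v / s) (m%n<n (p v) s) (rank<n u) rank-mono-<
      (subst₂ _<_ (digits u) (digits v) pu<pv)

    compress-near : ∀ {u v} → p v < p u + s → compress v < compress u + n
    compress-near {u} {v} pv<pu+s = subst (compress v <_) (sym (carry _ (p u / s) n))
      (change-base-< (p v / s) (suc (p u / s)) (m%n<n (p u) s) (rank<n v) rank-mono-<
        (subst₂ _<_ (digits v) (digits-+s u) pv<pu+s))

    -- Being non-strict, this is shown by contraposition: the base is changed back from n to s, and
    -- ranks reflect the order of residues.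
    compress-far : ∀ {u v} → p u + s ≤ p v → compress u + n ≤ compress v
    compress-far {u} {v} pu+s≤pv = ≮⇒≥ λ lt → <⇒≱ (near lt) pu+s≤pv
      where
      near : compress v < compress u + n → p v < p u + s
      near lt = subst₂ _<_ (sym (digits v)) (sym (digits-+s u))
        (change-base-< (p v / s) (suc (p u / s)) (rank<n u) (m%n<n (p v) s) rank-cancel-<
          (subst (compress v <_) (carry _ (p u / s) n) lt))

-- The host: an X with four arms of equal length.

pattern nw = zero
pattern ne = suc zero
pattern sw = suc (suc zero)
pattern se = suc (suc (suc zero))

-- The clique of the host lies on the arms nw and se, its independent set on ne and sw, and the
-- second component of a place is the distance from the centre. The second coordinate in ℤ × ℕ
-- breaks ties: at equal distances a clique vertex counts as closer to the centre.
module Host (n N : ℕ) where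

  plane : StrictTotalOrder 0ℓ 0ℓ 0ℓ
  plane = ×-strictTotalOrder ℤ.<-strictTotalOrder <-strictTotalOrder

  Place : Set
  Place = Fin 4 × ℕ

  X Y : Place → ℤ × ℕ
  X (nw , t) = -[1+ t ] , 1
  X (ne , t) = + t , 1
  X (sw , t) = -[1+ t ] , 0
  X (se , t) = + t , 0
  Y (nw , t) = + t , 0
  Y (ne , t) = + t , 1
  Y (sw , t) = -[1+ t ] , 0
  -- The shift by n matters only against `sw`: there it turns comparison of distances into
  -- comparison of their difference with n.
  Y (se , t) = -[1+ t + n ] , 1

  open StrictTotalOrder plane using (_≈_)
  open Plane plane X Y public

  -- Left inverses give injectivity without comparing all pairs of arms.
  X⁻¹ Y⁻¹ : ℤ × ℕ → Place
  X⁻¹ (-[1+ t ] , zero)  = sw , t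
  X⁻¹ (-[1+ t ] , suc _) = nw , t
  X⁻¹ (+ t , zero)       = se , t
  X⁻¹ (+ t , suc _)      = ne , t
  Y⁻¹ (-[1+ t ] , zero)  = sw , t
  Y⁻¹ (-[1+ t ] , suc _) = se , t ∸ n
  Y⁻¹ (+ t , zero)       = nw , t
  Y⁻¹ (+ t , suc _)      = ne , t

  X⁻¹∘X : ∀ u → X⁻¹ (X u) ≡ u
  X⁻¹∘X (nw , _) = refl
  X⁻¹∘X (ne , _) = refl
  X⁻¹∘X (sw , _) = refl
  X⁻¹∘X (se , _) = refl

  Y⁻¹∘Y : ∀ u → Y⁻¹ (Y u) ≡ u
  Y⁻¹∘Y (nw , _) = refl
  Y⁻¹∘Y (ne , _) = refl
  Y⁻¹∘Y (sw , _) = refl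
  Y⁻¹∘Y (se , t) = cong (se ,_) (m+n∸n≡m t n)

  X-injective : Injective _≡_ _≈_ X
  X-injective {u} {v} eq = trans (sym (X⁻¹∘X u)) (trans (cong X⁻¹ (×-≡,≡→≡ eq)) (X⁻¹∘X v))

  Y-injective : Injective _≡_ _≈_ Y
  Y-injective {u} {v} eq = trans (sym (Y⁻¹∘Y u)) (trans (cong Y⁻¹ (×-≡,≡→≡ eq)) (Y⁻¹∘Y v))

  inClique : Fin 4 → Bool
  inClique nw = true
  inClique ne = false
  inClique sw = false
  inClique se = true

  clique-inverted : ∀ {u v} → u ≢ v → inClique (proj₁ u) ≡ true → inClique (proj₁ v) ≡ true → Inverted u v
  clique-inverted {nw , t} {nw , u} u≢v _ _ with <-cmp t u
  ... | tri< t<u _ _ = inj₂ (inj₁ (-<- t<u) , inj₁ (+<+ t<u))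
  ... | tri≈ _ refl _ = contradiction refl u≢v
  ... | tri> _ _ u<t = inj₁ (inj₁ (-<- u<t) , inj₁ (+<+ u<t))
  clique-inverted {nw , t} {se , u} _ _ _ = inj₁ (inj₁ -<+ , inj₁ -<+)
  clique-inverted {se , t} {nw , u} _ _ _ = inj₂ (inj₁ -<+ , inj₁ -<+)
  clique-inverted {se , t} {se , u} u≢v _ _ with <-cmp t u
  ... | tri< t<u _ _ = inj₁ (inj₁ (+<+ t<u) , inj₁ (-<- (+-monoˡ-< n t<u)))
  ... | tri≈ _ refl _ = contradiction refl u≢v
  ... | tri> _ _ u<t = inj₂ (inj₁ (+<+ u<t) , inj₁ (-<- (+-monoˡ-< n u<t)))

  independent-concordant : ∀ {u v} → u ≢ v → inClique (proj₁ u) ≡ false → inClique (proj₁ v) ≡ false → Concordant u v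
  independent-concordant {ne , t} {ne , u} u≢v _ _ with <-cmp t u
  ... | tri< t<u _ _ = inj₁ (inj₁ (+<+ t<u) , inj₁ (+<+ t<u))
  ... | tri≈ _ refl _ = contradiction refl u≢v
  ... | tri> _ _ u<t = inj₂ (inj₁ (+<+ u<t) , inj₁ (+<+ u<t))
  independent-concordant {ne , t} {sw , u} _ _ _ = inj₂ (inj₁ -<+ , inj₁ -<+)
  independent-concordant {sw , t} {ne , u} _ _ _ = inj₁ (inj₁ -<+ , inj₁ -<+)
  independent-concordant {sw , t} {sw , u} u≢v _ _ with <-cmp t u
  ... | tri< t<u _ _ = inj₂ (inj₁ (-<- t<u) , inj₁ (-<- t<u))
  ... | tri≈ _ refl _ = contradiction refl u≢v
  ... | tri> _ _ u<t = inj₁ (inj₁ (-<- u<t) , inj₁ (-<- u<t))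

  independent-concordant {se , _} _ ()
  independent-concordant {ne , _} {se , _} _ _ ()
  independent-concordant {sw , _} {se , _} _ _ ()

  module _ {t u : ℕ} where

    nw-ne-inverted : u < t → Inverted (nw , t) (ne , u)
    nw-ne-inverted u<t = inj₁ (inj₁ -<+ , inj₁ (+<+ u<t))

    nw-ne-concordant : t < u → Concordant (nw , t) (ne , u)
    nw-ne-concordant t<u = inj₁ (inj₁ -<+ , inj₁ (+<+ t<u))

    nw-sw-inverted : u < t → Inverted (nw , t) (sw , u)
    nw-sw-inverted u<t = inj₁ (inj₁ (-<- u<t) , inj₁ -<+)

    nw-sw-concordant : t < u → Concordant (nw , t) (sw , u)
    nw-sw-concordant t<u = inj₂ (inj₁ (-<- t<u) , inj₁ -<+)

    se-ne-inverted : u < t → Inverted (se , t) (ne , u)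
    se-ne-inverted u<t = inj₂ (inj₁ (+<+ u<t) , inj₁ -<+)

    se-ne-concordant : t < u → Concordant (se , t) (ne , u)
    se-ne-concordant t<u = inj₁ (inj₁ (+<+ t<u) , inj₁ -<+)

    se-sw-inverted : u < t + n → Inverted (se , t) (sw , u)
    se-sw-inverted u<t+n = inj₂ (inj₁ -<+ , inj₁ (-<- u<t+n))

    se-sw-concordant : t + n ≤ u → Concordant (se , t) (sw , u)
    se-sw-concordant t+n≤u with m≤n⇒m<n∨m≡n t+n≤u
    ... | inj₁ t+n<u = inj₂ (inj₁ -<+ , inj₁ (-<- t+n<u))
    -- At a difference of exactly n the tags 0 and 1 decide for non-adjacency, so far means at least
    -- n.
    ... | inj₂ refl  = inj₂ (inj₁ -<+ , inj₂ (refl , s≤s z≤n))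

  place : Fin (4 * N) → Place
  place v = Product.map₂ toℕ (remQuot N v)

  vertex : ∀ (p : Place) → proj₂ p < N → Fin (4 * N)
  vertex (c , _) t<N = combine c (fromℕ< t<N)

  place-vertex : ∀ p (t<N : proj₂ p < N) → place (vertex p t<N) ≡ p
  place-vertex (c , t) t<N = trans (cong (Product.map₂ toℕ) (remQuot-combine c (fromℕ< t<N))) (cong (c ,_) (toℕ-fromℕ< t<N))

  place-injective : Injective _≡_ _≡_ place
  place-injective {u} {v} eq = begin
    u                              ≡⟨ combine-remQuot {4} N u ⟨
    uncurry combine (remQuot N u)  ≡⟨ cong (uncurry combine) (×-≡,≡→≡ (cong proj₁ eq , toℕ-injective (cong proj₂ eq))) ⟩
    uncurry combine (remQuot N v)  ≡⟨ combine-remQuot {4} N v ⟩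
    v                              ∎
    where open ≡-Reasoning

  open InversionGraph plane (X ∘ place) (Y ∘ place) using (graph; isPermutationGraph) public

  isSplitPermutationGraph : IsSplitPermutationGraph graph
  isSplitPermutationGraph =
    ( inClique ∘ proj₁ ∘ place
    , (λ i j i≢j ci cj → dec-true (inverted? (place i) (place j)) (clique-inverted (i≢j ∘ place-injective) ci cj))
    , independent)
    , isPermutationGraph (place-injective ∘ X-injective) (place-injective ∘ Y-injective)
    where
    independent : ∀ i j → inClique (proj₁ (place i)) ≡ false → inClique (proj₁ (place j)) ≡ false → adj graph i j ≡ false
    independent i j ci cj with i Fin.≟ j
    ... | yes refl = Graph.irrefl graph i
    ... | no i≢j   = dec-false (inverted? (place i) (place j))
                       (concordant⇒¬inverted (place i) (place j) (independent-concordant (i≢j ∘ place-injective) ci cj))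

-- The guest: clique parts and reaches.

module Guest {n} (inC : Fin n → Bool) (X Y : Fin n → ℕ) (X-injective : Injective _≡_ _≡_ X) (Y-injective : Injective _≡_ _≡_ Y)
  (clique : ∀ {k k′} → inC k ≡ true → inC k′ ≡ true → X k < X k′ → Y k′ < Y k)
  (independent : ∀ {i i′} → inC i ≡ false → inC i′ ≡ false → X i < X i′ → Y i < Y i′) where

  -- The first argument lies in the named direction from the second. A clique vertex k and an
  -- independent i are adjacent iff `NW k i` or `SE k i`.
  NW SE SW : Fin n → Fin n → Set
  NW k i = X k < X i × Y i < Y k
  SE k i = X i < X k × Y k < Y i
  SW k i = X k < X i × Y k < Y i

  inC? : ∀ c v → Dec (inC v ≡ c)
  inC? c v = inC v Bool.≟ c

  NW? : ∀ k i → Dec (NW k i)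
  NW? k i = (X k <? X i) ×-dec (Y i <? Y k)

  SE? : ∀ k i → Dec (SE k i)
  SE? k i = (X i <? X k) ×-dec (Y k <? Y i)

  SW? : ∀ k i → Dec (SW k i)
  SW? k i = (X k <? X i) ×-dec (Y k <? Y i)

  -- Membership in K₁ or K₂ avoids choosing a centre: every k above and to the left of it that
  -- has a neighbour outside the clique is in K₁.
  K₁ K₂ : Fin n → Set
  K₁ k = inC k ≡ true × ∃ λ i → inC i ≡ false × NW k i
  K₂ k = inC k ≡ true × ¬ ∃ λ i → inC i ≡ false × NW k i

  someNW? : ∀ k → Dec (∃ λ i → inC i ≡ false × NW k i)
  someNW? k = any? (λ i → inC? false i ×-dec NW? k i)

  K₁? : Decidable K₁
  K₁? k = inC? true k ×-dec someNW? k

  K₂? : Decidable K₂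
  K₂? k = inC? true k ×-dec ¬? (someNW? k)

  -- Otherwise i lies up and left of k while the witness i′ lies down and right of it, against the
  -- independent set being increasing. So each part of the clique meets the independent set in one
  -- direction only.
  K₁-¬SE : ∀ {k i} → K₁ k → inC i ≡ false → ¬ SE k i
  K₁-¬SE (_ , i′ , i′∈ , xk<xi′ , yi′<yk) i∈ (xi<xk , yk<yi) =
    <-asym (independent i∈ i′∈ (<-trans xi<xk xk<xi′)) (<-trans yi′<yk yk<yi)

  X-≤⇒Y-≥ : ∀ {k k′} → inC k ≡ true → inC k′ ≡ true → X k ≤ X k′ → Y k′ ≤ Y k
  X-≤⇒Y-≥ k∈ k′∈ xk≤xk′ with m≤n⇒m<n∨m≡n xk≤xk′
  ... | inj₁ xk<xk′ = <⇒≤ (clique k∈ k′∈ xk<xk′)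
  ... | inj₂ xk≡xk′ = ≤-reflexive (cong Y (sym (X-injective xk≡xk′)))

  Y-≤⇒X-≥ : ∀ {k k′} → inC k ≡ true → inC k′ ≡ true → Y k ≤ Y k′ → X k′ ≤ X k
  Y-≤⇒X-≥ k∈ k′∈ yk≤yk′ = ≮⇒≥ λ xk<xk′ → <⇒≱ (clique k∈ k′∈ xk<xk′) yk≤yk′

  beyond₁? : ∀ i → Decidable (λ k → K₁ k × ¬ NW k i)
  beyond₁? i k = K₁? k ×-dec ¬? (NW? k i)

  beyond₂? : ∀ i → Decidable (λ k → K₂ k × ¬ SE k i)
  beyond₂? i k = K₂? k ×-dec ¬? (SE? k i)

  -- On K₁ the distance from the centre is measured by Y, on K₂ by X; reach₁ i and reach₂ i
  -- are the distances at which the neighbours of i begin.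
  reach₁ reach₂ : Fin n → ℕ
  reach₁ i = ⨆ (beyond₁? i) (suc ∘ Y)
  reach₂ i = ⨆ (beyond₂? i) (suc ∘ X)

  -- The clique is decreasing, so any k′ in K₁ at least as high as k is also at least as far left
  -- and is a neighbour of i; the missed ones are lower.
  NW⇒reach₁≤ : ∀ {k i} → K₁ k → NW k i → reach₁ i ≤ Y k
  NW⇒reach₁≤ {k} {i} (k∈ , _) (xk<xi , yi<yk) = ⨆-least (beyond₁? i) (suc ∘ Y) λ k′ ((k′∈ , _) , ¬nw) →
    ≰⇒> λ yk≤yk′ → ¬nw (≤-<-trans (Y-≤⇒X-≥ k∈ k′∈ yk≤yk′) xk<xi , <-≤-trans yi<yk yk≤yk′)

  ¬NW⇒<reach₁ : ∀ {k i} → K₁ k → ¬ NW k i → Y k < reach₁ i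
  ¬NW⇒<reach₁ {k} {i} k₁ ¬nw = ⨆-upper (beyond₁? i) (suc ∘ Y) (k₁ , ¬nw)

  SE⇒reach₂≤ : ∀ {k i} → K₂ k → SE k i → reach₂ i ≤ X k
  SE⇒reach₂≤ {k} {i} (k∈ , _) (xi<xk , yk<yi) = ⨆-least (beyond₂? i) (suc ∘ X) λ k′ ((k′∈ , _) , ¬se) →
    ≰⇒> λ xk≤xk′ → ¬se (<-≤-trans xi<xk xk≤xk′ , ≤-<-trans (X-≤⇒Y-≥ k∈ k′∈ xk≤xk′) yk<yi)

  ¬SE⇒<reach₂ : ∀ {k i} → K₂ k → ¬ SE k i → X k < reach₂ i
  ¬SE⇒<reach₂ {k} {i} k₂ ¬se = ⨆-upper (beyond₂? i) (suc ∘ X) (k₂ , ¬se)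

  reach-antitone : ∀ {i i′} → (∀ {k} → inC k ≡ true → NW k i → NW k i′) → (∀ {k} → inC k ≡ true → SE k i → SE k i′) →
                   reach₁ i′ ≤ reach₁ i × reach₂ i′ ≤ reach₂ i
  reach-antitone {i} {i′} nw⇒ se⇒ =
    ⨆-least (beyond₁? i′) _ (λ k (k₁ , ¬nw) → ⨆-upper (beyond₁? i) (suc ∘ Y) (k₁ , ¬nw ∘ nw⇒ (proj₁ k₁))) ,
    ⨆-least (beyond₂? i′) _ (λ k (k₂ , ¬se) → ⨆-upper (beyond₂? i) (suc ∘ X) (k₂ , ¬se ∘ se⇒ (proj₁ k₂)))

  -- Crossings and the redistribution of the independent set.

  X-apart : ∀ {k i} → inC k ≡ true → inC i ≡ false → ¬ X k < X i → X i < X k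
  X-apart {k} {i} k∈ i∈ xk≮xi = ≤∧≢⇒< (≮⇒≥ xk≮xi) λ eq →
    contradiction (trans (sym k∈) (trans (cong inC (X-injective (sym eq))) i∈)) λ ()

  Y-apart : ∀ {k i} → inC k ≡ true → inC i ≡ false → ¬ Y k < Y i → Y i < Y k
  Y-apart {k} {i} k∈ i∈ yk≮yi = ≤∧≢⇒< (≮⇒≥ yk≮yi) λ eq →
    contradiction (trans (sym k∈) (trans (cong inC (Y-injective (sym eq))) i∈)) λ ()

  -- The independent points beyond the decreasing clique. On this side, and on the other, both
  -- reaches are monotone in X in the same direction.
  Lower : Fin n → Set
  Lower i = ∃ λ k → inC k ≡ true × SW k i

  lower? : Decidable Lower
  lower? i = any? (λ k → inC? true k ×-dec SW? k i)

  lower⇒X<⇒Y< : ∀ {k i} → inC k ≡ true → Lower i → X i < X k → Y k < Y i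
  lower⇒X<⇒Y< k∈ (k′ , k′∈ , xk′<xi , yk′<yi) xi<xk = <-trans (clique k′∈ k∈ (<-trans xk′<xi xi<xk)) yk′<yi

  -- Moving up and right only gains neighbours here: a neighbour of i lost by i′ would lie
  -- south-west of i′.
  reach-¬lower : ∀ {i i′} → inC i ≡ false → inC i′ ≡ false → ¬ Lower i′ → X i < X i′ →
                 reach₁ i′ ≤ reach₁ i × reach₂ i′ ≤ reach₂ i
  reach-¬lower i∈ i′∈ ¬l xi<xi′ = reach-antitone
    (λ k∈ (xk<xi , yi<yk) → let xk<xi′ = <-trans xk<xi xi<xi′ in
      xk<xi′ , Y-apart k∈ i′∈ (λ yk<yi′ → ¬l (_ , k∈ , xk<xi′ , yk<yi′)))
    (λ k∈ (xi<xk , yk<yi) → let yk<yi′ = <-trans yk<yi (independent i∈ i′∈ xi<xi′) in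
      X-apart k∈ i′∈ (λ xk<xi′ → ¬l (_ , k∈ , xk<xi′ , yk<yi′)) , yk<yi′)

  -- Here moving up and right only loses neighbours: a clique vertex south-west of i forces every
  -- clique vertex to the right of i below i, so neighbours of i′ are neighbours of i.
  reach-lower : ∀ {i i′} → inC i ≡ false → inC i′ ≡ false → Lower i → X i < X i′ →
                reach₁ i ≤ reach₁ i′ × reach₂ i ≤ reach₂ i′
  reach-lower {i} {i′} i∈ i′∈ l xi<xi′ = reach-antitone
    (λ k∈ (xk<xi′ , yi′<yk) → let yi<yk = <-trans yi<yi′ yi′<yk in
      ≰⇒> (λ xi≤xk → <-asym yi<yk (lower⇒X<⇒Y< k∈ l (X-apart k∈ i∈ (≤⇒≯ xi≤xk)))) , yi<yk)
    (λ k∈ (xi′<xk , yk<yi′) → let xi<xk = <-trans xi<xi′ xi′<xk in xi<xk , lower⇒X<⇒Y< k∈ l xi<xk)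
    where yi<yi′ = independent i∈ i′∈ xi<xi′

  Crossing : Fin n → Fin n → Set
  Crossing i i′ = reach₁ i < reach₁ i′ × reach₂ i′ < reach₂ i

  crossing⇒lower-≢ : ∀ {i i′} → inC i ≡ false → inC i′ ≡ false → Crossing i i′ → does (lower? i) ≢ does (lower? i′)
  crossing⇒lower-≢ {i} {i′} i∈ i′∈ (r₁< , r₂<) with lower? i | lower? i′ | <-cmp (X i) (X i′)
  ... | yes _ | no _   | _ = λ ()
  ... | no _  | yes _  | _ = λ ()
  ... | _     | _      | tri≈ _ xi≡xi′ _ = contradiction r₁< (<-irrefl (cong reach₁ (X-injective xi≡xi′)))
  ... | yes l | yes l′ | tri< xi<xi′ _ _ = contradiction (proj₂ (reach-lower i∈ i′∈ l xi<xi′)) (<⇒≱ r₂<)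
  ... | yes l | yes l′ | tri> _ _ xi′<xi = contradiction (proj₁ (reach-lower i′∈ i∈ l′ xi′<xi)) (<⇒≱ r₁<)
  ... | no ¬l | no ¬l′ | tri< xi<xi′ _ _ = contradiction (proj₁ (reach-¬lower i∈ i′∈ ¬l′ xi<xi′)) (<⇒≱ r₁<)
  ... | no ¬l | no ¬l′ | tri> _ _ xi′<xi = contradiction (proj₂ (reach-¬lower i′∈ i∈ ¬l xi′<xi)) (<⇒≱ r₂<)

  -- `Crossing` is transitive, so all three pairs would cross and need different values of `lower?`,
  -- but there are only two.
  no-three-crossing : ∀ {i j k} → inC i ≡ false → inC j ≡ false → inC k ≡ false → Crossing i j → ¬ Crossing j k
  no-three-crossing {i} {j} {k} i∈ j∈ k∈ ij jk
    with does (lower? i) | does (lower? j) | does (lower? k)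
       | crossing⇒lower-≢ i∈ j∈ ij | crossing⇒lower-≢ j∈ k∈ jk
       | crossing⇒lower-≢ i∈ k∈ (<-trans (proj₁ ij) (proj₁ jk) , <-trans (proj₂ jk) (proj₂ ij))
  ... | true  | true  | _     | i≢j | _   | _   = i≢j refl
  ... | true  | false | true  | _   | _   | i≢k = i≢k refl
  ... | true  | false | false | _   | j≢k | _   = j≢k refl
  ... | false | false | _     | i≢j | _   | _   = i≢j refl
  ... | false | true  | false | _   | _   | i≢k = i≢k refl
  ... | false | true  | true  | _   | j≢k | _   = j≢k refl

  -- `Crossing` is a strict partial order on the independent set with chains of at most two
  -- elements; B holds its maximal elements and A the rest, so neither contains a crossing.
  A B : Fin n → Set
  A i = inC i ≡ false × ∃ λ i′ → inC i′ ≡ false × Crossing i i′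
  B i = inC i ≡ false × ¬ ∃ λ i′ → inC i′ ≡ false × Crossing i i′

  someCrossing? : ∀ i → Dec (∃ λ i′ → inC i′ ≡ false × Crossing i i′)
  someCrossing? i = any? (λ i′ → inC? false i′ ×-dec ((reach₁ i <? reach₁ i′) ×-dec (reach₂ i′ <? reach₂ i)))

  A? : Decidable A
  A? i = inC? false i ×-dec someCrossing? i

  B-¬crossing : ∀ {b i} → B b → inC i ≡ false → ¬ Crossing b i
  B-¬crossing (_ , ¬∃) i∈ bi = ¬∃ (_ , i∈ , bi)

  A-¬crossing : ∀ {a a′} → A a → A a′ → ¬ Crossing a a′
  A-¬crossing (a∈ , _) (a′∈ , i , i∈ , a′i) aa′ = no-three-crossing a∈ a′∈ i∈ aa′ a′i

  data OnArm (v : Fin n) : Fin 4 → Set where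
    on-nw : K₁ v → OnArm v nw
    on-ne : A v → OnArm v ne
    on-sw : B v → OnArm v sw
    on-se : K₂ v → OnArm v se

  abstract
    classify : ∀ v → ∃ (OnArm v)
    classify v with inC v in v∈ | someNW? v | someCrossing? v
    ... | true  | yes ∃nw | _      = nw , on-nw (v∈ , ∃nw)
    ... | true  | no ∄nw  | _      = se , on-se (v∈ , ∄nw)
    ... | false | _       | yes ∃x = ne , on-ne (v∈ , ∃x)
    ... | false | _       | no ∄x  = sw , on-sw (v∈ , ∄x)

  arm : Fin n → Fin 4
  arm v = proj₁ (classify v)

  arm⇒ : ∀ {v c} → arm v ≡ c → OnArm v c
  arm⇒ {v} eq = subst (OnArm v) eq (proj₂ (classify v))

  arm⇒B : ∀ {v} → arm v ≡ sw → B v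
  arm⇒B {v} eq with on-sw b∈B ← arm⇒ {v} eq = b∈B

  arm⇒K₂ : ∀ {v} → arm v ≡ se → K₂ v
  arm⇒K₂ {v} eq with on-se k₂ ← arm⇒ {v} eq = k₂

  -- The common line and its far pairs.

  inside? : ∀ k → Decidable (λ a → A a × reach₂ a ≤ X k)
  inside? k a = A? a ×-dec (reach₂ a ≤? X k)

  -- Together with X k, this places k in K₂ right after those a in A with reach₂ a ≤ X k.
  innerReach : Fin n → ℕ
  innerReach k = ⨆ (inside? k) reach₁

  weights keys : StrictTotalOrder 0ℓ 0ℓ 0ℓ
  weights = ×-strictTotalOrder <-strictTotalOrder (×-strictTotalOrder <-strictTotalOrder <-strictTotalOrder)
  keys    = ×-strictTotalOrder weights <-strictTotalOrder

  open StrictTotalOrder weights using () renaming (_<_ to _≺_)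

  -- The first component settles K₁ against the independent set, and the first two settle K₂ against
  -- A. The last one breaks ties: k in K₁ precedes an i whose reach starts right after it, and k in
  -- K₂ follows an a with equal entries.
  weight : Fin 4 → Fin n → ℕ × ℕ × ℕ
  weight nw v = suc (Y v) , 0 , 0
  weight ne v = reach₁ v , reach₂ v , 1
  weight sw v = reach₁ v , reach₂ v , 1
  weight se v = innerReach v , X v , 2

  -- Independent vertices may have equal reaches; the index makes the keys distinct.
  key : Fin n → (ℕ × ℕ × ℕ) × ℕ
  key v = weight (arm v) v , toℕ v

  open Rank keys key using (rank; rank<n; rank-mono-<; rank-injective)

  rank-inj : Injective _≡_ _≡_ rank
  rank-inj = rank-injective (λ eq → toℕ-injective (proj₂ eq))

  weight-< : ∀ {u v c d} → arm u ≡ c → arm v ≡ d → weight c u ≺ weight d v → rank u < rank v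
  weight-< refl refl u≺v = rank-mono-< (inj₁ u≺v)

  lex-≤ : ∀ {a a′ b b′ c c′} → a ≤ a′ → (b < b′) ⊎ (b ≡ b′ × c < c′) → (a , b , c) ≺ (a′ , b′ , c′)
  lex-≤ a≤a′ rest with m≤n⇒m<n∨m≡n a≤a′
  ... | inj₁ a<a′ = inj₁ a<a′
  ... | inj₂ a≡a′ = inj₂ (a≡a′ , rest)

  lex-≤-≤ : ∀ {a a′ b b′ c c′} → a ≤ a′ → b ≤ b′ → c < c′ → (a , b , c) ≺ (a′ , b′ , c′)
  lex-≤-≤ a≤a′ b≤b′ c<c′ with m≤n⇒m<n∨m≡n b≤b′
  ... | inj₁ b<b′ = lex-≤ a≤a′ (inj₁ b<b′)
  ... | inj₂ b≡b′ = lex-≤ a≤a′ (inj₂ (b≡b′ , c<c′))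

  K₁-above : ∀ {k i} → K₁ k → NW k i → weight ne i ≺ weight nw k
  K₁-above k₁ nwki = inj₁ (s≤s (NW⇒reach₁≤ k₁ nwki))

  K₁-below : ∀ {k i} → K₁ k → ¬ NW k i → weight nw k ≺ weight ne i
  K₁-below k₁ ¬nw = lex-≤-≤ (¬NW⇒<reach₁ k₁ ¬nw) z≤n (s≤s z≤n)

  K₂-above-A : ∀ {k a} → K₂ k → A a → SE k a → weight ne a ≺ weight se k
  K₂-above-A {k} k₂ a∈A seka = lex-≤-≤ (⨆-upper (inside? k) reach₁ (a∈A , reach≤)) reach≤ (s≤s (s≤s z≤n))
    where reach≤ = SE⇒reach₂≤ k₂ seka

  -- A member a counted in `innerReach k` has `reach₂ a ≤ X k < reach₂ i`, so a larger `reach₁ a`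
  -- would make i cross a.
  innerReach≤ : ∀ {k i} → (∀ {a} → A a → ¬ Crossing i a) → X k < reach₂ i → innerReach k ≤ reach₁ i
  innerReach≤ {k} ¬crossing xk< = ⨆-least (inside? k) reach₁ λ a (a∈A , reach≤) →
    ≮⇒≥ λ r₁< → ¬crossing a∈A (r₁< , ≤-<-trans reach≤ xk<)

  K₂-below-A : ∀ {k a} → K₂ k → A a → ¬ SE k a → weight se k ≺ weight ne a
  K₂-below-A k₂ a∈A ¬se = lex-≤ (innerReach≤ (A-¬crossing a∈A) xk<) (inj₁ xk<)
    where xk< = ¬SE⇒<reach₂ k₂ ¬se

  -- `innerReach` ignores B, so a neighbour of b in K₂ may precede b as well. Precedence alone
  -- cannot encode this adjacency, hence `Far`.
  K₂-below-B : ∀ {k b} → B b → X k < reach₂ b → weight se k ≺ weight sw b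
  K₂-below-B b∈B xk< = lex-≤ (innerReach≤ (B-¬crossing b∈B ∘ proj₁) xk<) (inj₁ xk<)

  K₂-ordered : ∀ {k k′} → X k < X k′ → weight se k ≺ weight se k′
  K₂-ordered {k} {k′} xk<xk′ = lex-≤
    (⨆-least (inside? k) reach₁ (λ a (a∈A , reach≤) → ⨆-upper (inside? k′) reach₁ (a∈A , ≤-trans reach≤ (<⇒≤ xk<xk′))))
    (inj₁ xk<xk′)

  -- The least relation, monotone in the sense of `UnitInterval`, that contains every pair of ranks
  -- of a k in K₂ and a b in B missing it.
  Far : ℕ → ℕ → Set
  Far x y = ∃ λ b → ∃ λ k → arm b ≡ sw × arm k ≡ se × X k < reach₂ b × rank b ≤ y × x ≤ rank k

  Far? : ∀ x y → Dec (Far x y)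
  Far? x y = any? λ b → any? λ k →
    (arm b Fin.≟ sw) ×-dec (arm k Fin.≟ se) ×-dec (X k <? reach₂ b) ×-dec (rank b ≤? y) ×-dec (x ≤? rank k)

  Far-mono : ∀ {x x′ y y′} → x′ ≤ x → y ≤ y′ → Far x y → Far x′ y′
  Far-mono x′≤x y≤y′ (b , k , b-sw , k-se , xk< , rb≤y , x≤rk) =
    b , k , b-sw , k-se , xk< , ≤-trans rb≤y y≤y′ , ≤-trans x′≤x x≤rk

  Far⇒< : ∀ {x y} → Far x y → x < y
  Far⇒< (b , k , b-sw , k-se , xk< , rb≤y , x≤rk) =
    ≤-<-trans x≤rk (<-≤-trans (weight-< k-se b-sw (K₂-below-B (arm⇒B b-sw) xk<)) rb≤y)

  ¬SE⇒Far : ∀ {k b} → arm k ≡ se → arm b ≡ sw → ¬ SE k b → Far (rank k) (rank b)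
  ¬SE⇒Far {k} {b} k-se b-sw ¬se = b , k , b-sw , k-se , ¬SE⇒<reach₂ (arm⇒K₂ k-se) ¬se , ≤-refl , ≤-refl

  -- The closure adds no false pair. A witness k′, b′ would give
  -- `reach₂ b ≤ X k ≤ X k′ < reach₂ b′`; as b′ does not cross b, also `reach₁ b ≤ reach₁ b′`, so b
  -- precedes b′, contrary to the witness.
  SE⇒¬Far : ∀ {k b} → arm k ≡ se → arm b ≡ sw → SE k b → ¬ Far (rank k) (rank b)
  SE⇒¬Far {k} {b} k-se b-sw sekb (b′ , k′ , b′-sw , k′-se , xk′< , rb′≤rb , rk≤rk′) =
    <⇒≱ (weight-< b-sw b′-sw (lex-≤ r₁≤ (inj₁ r₂<))) rb′≤rb
    where
    xk≤xk′ : X k ≤ X k′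
    xk≤xk′ = ≮⇒≥ λ xk′<xk → <⇒≱ (weight-< k′-se k-se (K₂-ordered xk′<xk)) rk≤rk′
    r₂< : reach₂ b < reach₂ b′
    r₂< = ≤-<-trans (≤-trans (SE⇒reach₂≤ (arm⇒K₂ k-se) sekb) xk≤xk′) xk′<
    r₁≤ : reach₁ b ≤ reach₁ b′
    r₁≤ = ≮⇒≥ λ r₁< → B-¬crossing (arm⇒B b′-sw) (proj₁ (arm⇒B b-sw)) (r₁< , r₂<)

  open UnitInterval Far? Far-mono Far⇒<
  open Representation (representation n)

  instance
    unit≢0 : NonZero unit
    unit≢0 = >-nonZero unit>0

  position : Fin n → ℕ
  position v = place (rank v)

  open Compress position unit

  distance : Fin n → ℕ
  distance = compress

  distance<n*n : ∀ v → distance v < n * n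
  distance<n*n = compress<n*n λ v → <-≤-trans (bounded (rank<n v)) (*-monoʳ-≤ unit (rank<n v))

  distance-mono-< : ∀ {u v} → rank u < rank v → distance u < distance v
  distance-mono-< {u} {v} ru<rv = compress-mono-< {u} {v} (monotone ru<rv (rank<n v))

  distance-injective : Injective _≡_ _≡_ distance
  distance-injective = mono-<⇒injective rank distance (λ {u} {v} → distance-mono-< {u} {v}) rank-inj

  clash : ∀ {v} {Z : Set} → inC v ≡ true → inC v ≡ false → Z
  clash v∈ v∉ = contradiction (trans (sym v∈) v∉) λ ()

  -- Embedding the guest in the host.

  module Embedding (N : ℕ) (n*n≤N : n * n ≤ N) where
    module Source = Plane <-strictTotalOrder X Y
    module Target = Host n N

    spot : Fin n → Fin 4 × ℕ
    spot v = arm v , distance v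

    spot-injective : Injective _≡_ _≡_ spot
    spot-injective eq = distance-injective (cong proj₂ eq)

    inClique-arm : ∀ {v c} → OnArm v c → Target.inClique c ≡ inC v
    inClique-arm (on-nw (v∈ , _)) = sym v∈
    inClique-arm (on-ne (v∈ , _)) = sym v∈
    inClique-arm (on-sw (v∈ , _)) = sym v∈
    inClique-arm (on-se (v∈ , _)) = sym v∈

    inClique-spot : ∀ {v c} → inC v ≡ c → Target.inClique (proj₁ (spot v)) ≡ c
    inClique-spot {v} v∈ = trans (inClique-arm (arm⇒ {v} refl)) v∈

    closer : ∀ {u v c d} → arm u ≡ c → arm v ≡ d → weight c u ≺ weight d v → distance u < distance v
    closer {u} {v} u-c v-d u≺v = distance-mono-< {u} {v} (weight-< u-c v-d u≺v)

    -- The arms are variables with equations, so that matching on `OnArm` refines them while `arm k`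
    -- and `arm i` stay known. Only K₂ against B uses the unit; the other possible cases compare
    -- places on the line.
    spot-inverted : ∀ {k i c d} → arm k ≡ c → arm i ≡ d → OnArm k c → OnArm i d →
                    inC k ≡ true → inC i ≡ false → NW k i ⊎ SE k i → Target.Inverted (c , distance k) (d , distance i)
    spot-inverted _ _ (on-ne (k∉ , _)) _ k∈ _ _ = clash k∈ k∉
    spot-inverted _ _ (on-sw (k∉ , _)) _ k∈ _ _ = clash k∈ k∉
    spot-inverted _ _ _ (on-nw (i∈ , _)) _ i∉ _ = clash i∈ i∉
    spot-inverted _ _ _ (on-se (i∈ , _)) _ i∉ _ = clash i∈ i∉
    spot-inverted _ _ (on-nw k₁) _ _ i∉ (inj₂ seki) = contradiction seki (K₁-¬SE k₁ i∉)
    spot-inverted _ _ (on-se (_ , ¬∃)) _ _ i∉ (inj₁ nwki) = contradiction (_ , i∉ , nwki) ¬∃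
    spot-inverted k-c i-d (on-nw k₁) (on-ne _) _ _ (inj₁ nwki) = Target.nw-ne-inverted (closer i-d k-c (K₁-above k₁ nwki))
    spot-inverted k-c i-d (on-nw k₁) (on-sw _) _ _ (inj₁ nwki) = Target.nw-sw-inverted (closer i-d k-c (K₁-above k₁ nwki))
    spot-inverted k-c i-d (on-se k₂) (on-ne a) _ _ (inj₂ seki) = Target.se-ne-inverted (closer i-d k-c (K₂-above-A k₂ a seki))
    spot-inverted {k} {i} k-c i-d (on-se _) (on-sw _) _ _ (inj₂ seki) = Target.se-sw-inverted
      (compress-near {k} {i} (near (rank<n k) (rank<n i) (SE⇒¬Far k-c i-d seki)))

    spot-concordant : ∀ {k i c d} → arm k ≡ c → arm i ≡ d → OnArm k c → OnArm i d →
                      inC k ≡ true → inC i ≡ false → ¬ (NW k i ⊎ SE k i) → Target.Concordant (c , distance k) (d , distance i)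
    spot-concordant _ _ (on-ne (k∉ , _)) _ k∈ _ _ = clash k∈ k∉
    spot-concordant _ _ (on-sw (k∉ , _)) _ k∈ _ _ = clash k∈ k∉
    spot-concordant _ _ _ (on-nw (i∈ , _)) _ i∉ _ = clash i∈ i∉
    spot-concordant _ _ _ (on-se (i∈ , _)) _ i∉ _ = clash i∈ i∉
    spot-concordant k-c i-d (on-nw k₁) (on-ne _) _ _ ¬inv = Target.nw-ne-concordant (closer k-c i-d (K₁-below k₁ (¬inv ∘ inj₁)))
    spot-concordant k-c i-d (on-nw k₁) (on-sw _) _ _ ¬inv = Target.nw-sw-concordant (closer k-c i-d (K₁-below k₁ (¬inv ∘ inj₁)))
    spot-concordant k-c i-d (on-se k₂) (on-ne a) _ _ ¬inv = Target.se-ne-concordant (closer k-c i-d (K₂-below-A k₂ a (¬inv ∘ inj₂)))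
    spot-concordant {k} {i} k-c i-d (on-se _) (on-sw _) _ _ ¬inv = Target.se-sw-concordant
      (compress-far {k} {i} (far (rank<n i) (¬SE⇒Far k-c i-d (¬inv ∘ inj₂))))

    agree : Fin n → Fin n → Set
    agree u v = does (Source.inverted? u v) ≡ does (Target.inverted? (spot u) (spot v))

    agree-sym : ∀ {u v} → agree u v → agree v u
    agree-sym {u} {v} eq = begin
      does (Source.inverted? v u)                  ≡⟨ Source.inverted?-sym v u ⟩
      does (Source.inverted? u v)                  ≡⟨ eq ⟩
      does (Target.inverted? (spot u) (spot v))    ≡⟨ Target.inverted?-sym (spot u) (spot v) ⟩
      does (Target.inverted? (spot v) (spot u))    ∎
      where open ≡-Reasoning

    agree-clique-independent : ∀ {k i} → inC k ≡ true → inC i ≡ false → agree k i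
    agree-clique-independent {k} {i} k∈ i∉ = by (Source.inverted? k i)
      where
      by : (d : Dec (Source.Inverted k i)) → does d ≡ does (Target.inverted? (spot k) (spot i))
      by (yes inv) = sym (dec-true (Target.inverted? (spot k) (spot i))
        (spot-inverted refl refl (arm⇒ refl) (arm⇒ refl) k∈ i∉ inv))
      by (no ¬inv) = sym (dec-false (Target.inverted? (spot k) (spot i))
        (Target.concordant⇒¬inverted (spot k) (spot i)
          (spot-concordant refl refl (arm⇒ refl) (arm⇒ refl) k∈ i∉ ¬inv)))

    clique-inverted : ∀ {u v} → u ≢ v → inC u ≡ true → inC v ≡ true → Source.Inverted u v
    clique-inverted {u} {v} u≢v u∈ v∈ with <-cmp (X u) (X v)
    ... | tri< xu<xv _ _ = inj₁ (xu<xv , clique u∈ v∈ xu<xv)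
    ... | tri≈ _ xu≡xv _ = contradiction (X-injective xu≡xv) u≢v
    ... | tri> _ _ xv<xu = inj₂ (xv<xu , clique v∈ u∈ xv<xu)

    independent-concordant : ∀ {u v} → u ≢ v → inC u ≡ false → inC v ≡ false → Source.Concordant u v
    independent-concordant {u} {v} u≢v u∉ v∉ with <-cmp (X u) (X v)
    ... | tri< xu<xv _ _ = inj₁ (xu<xv , independent u∉ v∉ xu<xv)
    ... | tri≈ _ xu≡xv _ = contradiction (X-injective xu≡xv) u≢v
    ... | tri> _ _ xv<xu = inj₂ (xv<xu , independent v∉ u∉ xv<xu)

    agree-refl : ∀ u → agree u u
    agree-refl u = trans (dec-false (Source.inverted? u u) Source.inverted-irrefl)
      (sym (dec-false (Target.inverted? (spot u) (spot u)) (Target.inverted-irrefl {spot u})))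

    agree-distinct : ∀ {u v} c d → inC u ≡ c → inC v ≡ d → u ≢ v → agree u v
    agree-distinct true  false u∈ v∉ _ = agree-clique-independent u∈ v∉
    agree-distinct {u} {v} false true u∉ v∈ _ = agree-sym {v} {u} (agree-clique-independent v∈ u∉)
    agree-distinct {u} {v} true true u∈ v∈ u≢v = trans
      (dec-true (Source.inverted? u v) (clique-inverted u≢v u∈ v∈))
      (sym (dec-true (Target.inverted? (spot u) (spot v))
        (Target.clique-inverted (u≢v ∘ spot-injective) (inClique-spot u∈) (inClique-spot v∈))))
    agree-distinct {u} {v} false false u∉ v∉ u≢v = trans
      (dec-false (Source.inverted? u v) (Source.concordant⇒¬inverted u v (independent-concordant u≢v u∉ v∉)))
      (sym (dec-false (Target.inverted? (spot u) (spot v)) (Target.concordant⇒¬inverted (spot u) (spot v)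
        (Target.independent-concordant (u≢v ∘ spot-injective) (inClique-spot u∉) (inClique-spot v∉)))))

    agree-everywhere : ∀ u v → agree u v
    agree-everywhere u v = [ (λ { refl → agree-refl u }) , agree-distinct (inC u) (inC v) refl refl ]′ (toSum (u Fin.≟ v))

    distance<N : ∀ v → distance v < N
    distance<N v = <-≤-trans (distance<n*n v) n*n≤N

    embed : Fin n → Fin (4 * N)
    embed v = Target.vertex (spot v) (distance<N v)

    place-embed : ∀ v → Target.place (embed v) ≡ spot v
    place-embed v = Target.place-vertex (spot v) (distance<N v)

    embed-injective : Injective _≡_ _≡_ embed
    embed-injective {u} {v} eq = spot-injective (trans (sym (place-embed u)) (trans (cong Target.place eq) (place-embed v)))

    embed-adj : ∀ u v → does (Source.inverted? u v) ≡ adj Target.graph (embed u) (embed v)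
    embed-adj u v = trans (agree-everywhere u v)
      (sym (cong₂ (λ p q → does (Target.inverted? p q)) (place-embed u) (place-embed v)))

-- From split permutation graphs to drawings, and the theorem.

splitPermutationGraph-embeds : ∀ {n} N → n * n ≤ N → (H : Graph n) → IsSplitPermutationGraph H →
                               IsInducedSubgraph H (Host.graph n N)
splitPermutationGraph-embeds {n} N n*n≤N H ((inC , clique , independent) , π , f , adj≡) =
  embed , embed-injective , λ u v → trans (adj-inverted u v) (embed-adj u v)
  where
  X Y : Fin n → ℕ
  -- Each vertex is drawn at its value and its position, which makes adjacency the same as
  -- inversion.
  X v = toℕ (Inverse.to f v)
  Y v = toℕ (Inverse.from π (Inverse.to f v))

  X-injective : Injective _≡_ _≡_ X
  X-injective eq = Injection.injective (↔⇒↣ f) (toℕ-injective eq)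

  Y-injective : Injective _≡_ _≡_ Y
  Y-injective eq = Injection.injective (↔⇒↣ f) (Injection.injective (↔⇒↣ (↔-sym π)) (toℕ-injective eq))

  open Plane <-strictTotalOrder X Y

  ⌊<?⌋ : ∀ {m} (x y : Fin m) → ⌊ x Fin.<? y ⌋ ≡ does (StrictTotalOrder._<?_ <-strictTotalOrder (toℕ x) (toℕ y))
  ⌊<?⌋ x y = trans (isYes≗does (x Fin.<? y)) (does-≡ (x Fin.<? y) (StrictTotalOrder._<?_ <-strictTotalOrder (toℕ x) (toℕ y)))

  adj-inverted : ∀ u v → adj H u v ≡ does (inverted? u v)
  adj-inverted u v = trans (adj≡ u v) (cong₂ _∨_
    (cong₂ _∧_ (⌊<?⌋ xu xv) (⌊<?⌋ (Inverse.from π xv) (Inverse.from π xu)))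
    (cong₂ _∧_ (⌊<?⌋ xv xu) (⌊<?⌋ (Inverse.from π xu) (Inverse.from π xv))))
    where
    xu = Inverse.to f u
    xv = Inverse.to f v

  adj⇒inverted : ∀ {u v} → adj H u v ≡ true → Inverted u v
  adj⇒inverted {u} {v} uv = decidable-stable (inverted? u v) λ ¬inv →
    contradiction (trans (sym uv) (trans (adj-inverted u v) (dec-false (inverted? u v) ¬inv))) λ ()

  ¬adj⇒¬inverted : ∀ {u v} → adj H u v ≡ false → ¬ Inverted u v
  ¬adj⇒¬inverted {u} {v} ¬uv inv =
    contradiction (trans (sym ¬uv) (trans (adj-inverted u v) (dec-true (inverted? u v) inv))) λ ()

  decreasing : ∀ {k k′} → inC k ≡ true → inC k′ ≡ true → X k < X k′ → Y k′ < Y k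
  decreasing {k} {k′} k∈ k′∈ xk<xk′
    with adj⇒inverted (clique k k′ (λ k≡k′ → <-irrefl (cong X k≡k′) xk<xk′) k∈ k′∈)
  ... | inj₁ (_ , yk′<yk) = yk′<yk
  ... | inj₂ (xk′<xk , _) = contradiction xk<xk′ (<-asym xk′<xk)

  increasing : ∀ {i i′} → inC i ≡ false → inC i′ ≡ false → X i < X i′ → Y i < Y i′
  increasing {i} {i′} i∉ i′∉ xi<xi′ = ≤∧≢⇒<
    (≮⇒≥ (λ yi′<yi → ¬adj⇒¬inverted (independent i i′ i∉ i′∉) (inj₁ (xi<xi′ , yi′<yi))))
    (λ yi≡yi′ → <-irrefl (cong X (Y-injective yi≡yi′)) xi<xi′)

  open Guest inC X Y X-injective Y-injective decreasing increasing
  open Embedding N n*n≤N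

theorem4p3 : (n : ℕ) → n ≥ 1 →
    Σ (Graph (4 * n ^ 3)) λ G → IsSplitPermutationGraph G ×
      ((H : Graph n) → IsSplitPermutationGraph H → IsInducedSubgraph H G)
theorem4p3 n@(suc _) _ = Host.graph n (n ^ 3) , Host.isSplitPermutationGraph n (n ^ 3) ,
  splitPermutationGraph-embeds (n ^ 3) n*n≤n^3
  where
  n*n≤n^3 : n * n ≤ n ^ 3
  -- `n ^ 3` unfolds to `n * (n * n ^ 1)`, so `n ≤ n * n ^ 1` suffices, which holds as n is
  -- positive.
  n*n≤n^3 = *-monoʳ-≤ n (m≤m*n n (n ^ 1))
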